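{- For every integer $n \ge 2$, the equation $$x_1 - 2x_2 + 4x_3 - \cdots + (-1)^{n-1} 2^{n-1} x_n = 0, \quad\text{i.e.}\quad \sum_{i=1}^{n} (-2)^{i-1} x_i = 0,$$ in the $n$ variables $x_1, \dots, x_n$ is $(n-1)$-regular but not $n$-regular.
   Context: $\mathbb{N}$ denotes the set of positive integers. For a positive integer $r$, an $r$-coloring of the positive integers is any function $C : \mathbb{N} \to \{1, \dots, r\}$. A linear homogeneous equation $a_1 x_1 + \cdots + a_n x_n = 0$ (with all $a_i$ nonzero integers) is called $r$-regular if for every $r$-coloring $C$ of the positive integers there is a monochromatic solution, i.e. positive integers $x_1, \dots, x_n$ (not necessarily distinct) satisfying the equation with $C(x_1) = \cdots = C(x_n)$. -}

module Defs where

open import Data.Nat.Base as ℕ using (ℕ; zero; suc)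
open import Data.Integer.Base using (ℤ; +_; -[1+_]; 0ℤ; _*_; _^_; NonZero)
open import Data.Integer.Properties using (i*j≢0; +-0-monoid)
open import Data.Fin.Base using (Fin; toℕ)
open import Data.Vec.Functional using (Vector)
open import Data.Refinement.Base using (Refinement-syntax; value)
open import Data.Product.Base using (∃-syntax; _×_)
open import Relation.Binary.PropositionalEquality.Core using (_≡_)
open import Algebra.Properties.Monoid.Sum +-0-monoid using (sum-syntax)

-- The positivity proof is irrelevant, so a function on ℕ⁺ depends only on the
-- underlying number.
ℕ⁺ : Set
ℕ⁺ = [ m ∈ ℕ ∣ 0 ℕ.< m ]

Coloring : ℕ → Set
Coloring r = ℕ⁺ → Fin r

record LinearEquation (n : ℕ) : Set where
  field
    coeff         : Vector ℤ n
    coeff-nonZero : ∀ i → NonZero (coeff i)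

open LinearEquation public

IsSolution : ∀ {n} → LinearEquation n → Vector ℕ⁺ n → Set
IsSolution {n} E x = ∑[ i < n ] (coeff E i * + value (x i)) ≡ 0ℤ

Monochromatic : ∀ {r n} → Coloring r → Vector ℕ⁺ n → Set
Monochromatic C x = ∀ i j → C (x i) ≡ C (x j)

-- Only meant for r ≥ 1: there are no colorings with zero colors.
Regular : ∀ {n} → ℕ → LinearEquation n → Set
Regular r E =
  (C : Coloring r) → ∃[ x ] (IsSolution E x × Monochromatic C x)

neg2 : ℤ
neg2 = -[1+ 1 ]

neg2^k-nonZero : ∀ k → NonZero (neg2 ^ k)
neg2^k-nonZero zero    = _
neg2^k-nonZero (suc k) = i*j≢0 neg2 (neg2 ^ k) {{_}} {{neg2^k-nonZero k}}

-- Indices start at 0 here, so the exponent is i rather than i - 1.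
alternatingPowersOf2 : ∀ n → LinearEquation n
alternatingPowersOf2 n = record
  { coeff         = λ i → neg2 ^ toℕ i
  ; coeff-nonZero = λ i → neg2^k-nonZero (toℕ i)
  }

{-# OPTIONS --safe #-}
-- Not n-regular: colour x by its 2-adic valuation modulo n. On a monochromatic
-- tuple the terms (-2)^i x_i have pairwise different valuations, so their sum
-- has the least of these valuations and is not 0.
--
-- (n-1)-regular: induct on the number s < n of colours. Van der Waerden's theorem,
-- applied to the product colouring x ↦ (C(x), C(2x), …, C(2^s x)), gives a
-- progression a + jd along which each C(2^i (a + jd)) does not depend on j. Two of
-- these s + 1 colours agree, so for some u and 1 ≤ k ≤ s all the numbers
-- u(a + jd) and 2^k u(a + jd) have one colour c. Values u(a + Ld) and 2^k u(a + Ld)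
-- at two or three suitable positions cancel. If some D m with D = 2^k u d has
-- colour c, it serves for all other variables, and changing j in x₀ compensates for
-- them. Otherwise colour c is missing from the multiples D m, m ≤ M, which are
-- coloured by the remaining s - 1 colours.
module Submission where

open import Defs
open import Data.Nat.Base as ℕ using (ℕ; zero; suc; _≤_; _<_; _∸_; z≤n; s≤s)
import Data.Nat.Properties as ℕ
open import Data.Nat.DivMod using (_%_; _/_; _mod_; m%n<n; [m+kn]%n≡m%n; m<n⇒m%n≡m; m≡m%n+[m/n]*n)
open import Data.Nat.Induction using (<-wellFounded)
import Data.Nat.Tactic.RingSolver as ℕSolver
open import Data.Fin.Base as Fin using (Fin; zero; suc; toℕ; fromℕ<; funToFin; finToFun; punchOut; punchIn)
import Data.Fin.Properties as Fin
open import Data.Vec.Functional using (Vector; _∷_; head; tail)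
open import Data.Product.Base using (∃; _×_; _,_; proj₁; proj₂)
open import Data.Sum.Base using (_⊎_; inj₁; inj₂)
open import Data.Irrelevant using ([_])
open import Data.Refinement.Base using (_,_; value)
open import Function.Base using (_∘_)
open import Induction.WellFounded using (Acc; acc)
open import Relation.Nullary.Decidable.Core using (yes; no)
open import Relation.Nullary.Negation.Core using (¬_; contradiction)
open import Relation.Binary.Definitions using (tri<; tri≈; tri>)
open import Relation.Binary.PropositionalEquality

-- A product colouring is encoded as a single colour; this recovers the colour of each component.
funToFin-injective : ∀ {m n} (f g : Fin m → Fin n) → funToFin f ≡ funToFin g → f ≗ g
funToFin-injective {m} f g eq i = begin
  f i                              ≡⟨ Fin.finToFun-funToFin f i ⟨
  finToFun {n = m} (funToFin f) i  ≡⟨ cong (λ e → finToFun {n = m} e i) eq ⟩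
  finToFun {n = m} (funToFin g) i  ≡⟨ Fin.finToFun-funToFin g i ⟩
  g i                              ∎
  where open ≡-Reasoning

-- Van der Waerden's theorem

module _ where
  open import Data.Nat.Base using (_+_; _*_; _^_)
  open import Data.Nat.Properties
  open ℕSolver using (solve-∀)

  -- Here `l` counts steps, so there are `l + 1` terms. For `l = 0` the bound on the last term does
  -- not control `diff`, hence the separate field `diff≤W`.
  record MonochromaticAP {c} (f : ℕ → Fin c) (l W : ℕ) : Set where
    field
      start diff : ℕ
      diff>0     : 0 < diff
      diff≤W     : diff ≤ W
      end≤W      : start + l * diff ≤ W
      mono       : ∀ j → j ≤ l → f (start + j * diff) ≡ f start

  translate : ∀ {c l w W} {f : ℕ → Fin c} t → t + w ≤ W →
              MonochromaticAP (λ y → f (t + y)) l w → MonochromaticAP f l W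
  translate {l = l} {w} {W} {f} t t+w≤W ap = record
    { start  = t + start
    ; diff   = diff
    ; diff>0 = diff>0
    ; diff≤W = ≤-trans diff≤W (≤-trans (m≤n+m w t) t+w≤W)
    ; end≤W  = ≤-trans (≤-reflexive (+-assoc t start _)) (≤-trans (+-monoʳ-≤ t end≤W) t+w≤W)
    ; mono   = λ j j≤l → trans (cong f (+-assoc t start _)) (mono j j≤l)
    }
    where open MonochromaticAP ap

  -- k progressions of pairwise different colours, all of which would be extended
  -- by the same point.
  record Focused {c} (f : ℕ → Fin c) (l W k : ℕ) : Set where
    field
      focus         : ℕ
      focus≤W       : focus ≤ W
      diff          : Fin k → ℕ
      diff>0        : ∀ i → 0 < diff i
      end≤W         : ∀ i → focus + suc l * diff i ≤ W
      hue           : Fin k → Fin c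
      hue-injective : ∀ i j → hue i ≡ hue j → i ≡ j
      mono          : ∀ i j → j ≤ l → f (focus + suc j * diff i) ≡ hue i

  -- The focus lies one step before the first term of each progression, so it becomes the new start.
  extend : ∀ {c l W k} {f : ℕ → Fin c} (F : Focused f l W k) →
           ∀ i → Focused.hue F i ≡ f (Focused.focus F) → MonochromaticAP f (suc l) W
  extend {l = l} {f = f} F i hue≡ = record
    { start  = focus
    ; diff   = diff i
    ; diff>0 = diff>0 i
    ; diff≤W = ≤-trans (m≤m+n (diff i) _) (≤-trans (m≤n+m _ focus) (end≤W i))
    ; end≤W  = end≤W i
    ; mono   = λ { zero    _         → cong f (+-identityʳ focus)
                 ; (suc j) (s≤s j≤l) → trans (mono i j j≤l) hue≡ }
    }
    where open Focused F

  VanDerWaerden : ℕ → Set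
  VanDerWaerden l = ∀ c → ∃ λ W → (f : ℕ → Fin c) → MonochromaticAP f l W

  window : ∀ {c} → (ℕ → Fin c) → (w : ℕ) → ℕ → Fin (c ^ suc w)
  window f w x = funToFin {suc w} (λ y → f (x + toℕ y))

  window-≡ : ∀ {c} (f : ℕ → Fin c) w {x x′ y} → window f w x ≡ window f w x′ →
             y ≤ w → f (x + y) ≡ f (x′ + y)
  window-≡ f w {x} {x′} {y} eq y≤w =
    subst (λ z → f (x + z) ≡ f (x′ + z)) (Fin.toℕ-fromℕ< (s≤s y≤w))
          (funToFin-injective {suc w} (λ i → f (x + toℕ i)) (λ i → f (x′ + toℕ i)) eq
                              (fromℕ< (s≤s y≤w)))

  module _ {l} (vdW : VanDerWaerden l) (c : ℕ) where

    -- Induction on `k`: windows long enough for `k` focused progressions have finitely many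
    -- patterns, so `vdW` finds `l + 1` equal windows in progression. The copies of the focus in
    -- these windows form the additional progression.
    focusing : ∀ k → ∃ λ W → (f : ℕ → Fin c) →
               MonochromaticAP f (suc l) W ⊎ Focused f l W k
    focusing zero = 0 , λ f → inj₂ record
      { focus = 0 ; focus≤W = z≤n
      ; diff = λ () ; diff>0 = λ () ; end≤W = λ ()
      ; hue = λ () ; hue-injective = λ () ; mono = λ () }
    focusing (suc k) = V + V + w , step
      where
      w = proj₁ (focusing k)
      V = proj₁ (vdW (c ^ suc w))

      step : (f : ℕ → Fin c) →
             MonochromaticAP f (suc l) (V + V + w) ⊎ Focused f l (V + V + w) (suc k)
      step f = result (proj₂ (focusing k) (λ y → f (t + y)))
        where
        -- Colouring from V on leaves room for one more term to the left of the
        -- progression of windows.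
        ap = proj₂ (vdW (c ^ suc w)) (λ x → window f w (V + x))
        open MonochromaticAP ap using () renaming (start to a; diff to D)
        module AP = MonochromaticAP ap
        b = a + (V ∸ D)
        t = V + a

        b+jD : ∀ j → b + suc j * D ≡ V + (a + j * D)
        b+jD j = begin
          a + (V ∸ D) + (D + j * D)   ≡⟨ regroup a (V ∸ D) D (j * D) ⟩
          (V ∸ D + D) + (a + j * D)   ≡⟨ cong (_+ (a + j * D)) (m∸n+n≡m AP.diff≤W) ⟩
          V + (a + j * D)             ∎
          where
          open ≡-Reasoning
          regroup : ∀ a v D x → a + v + (D + x) ≡ (v + D) + (a + x)
          regroup = solve-∀

        shift : ∀ j y → j ≤ l → y ≤ w → f (b + suc j * D + y) ≡ f (t + y)
        shift j y j≤l y≤w = trans (cong (λ z → f (z + y)) (b+jD j))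
                                  (window-≡ f w (AP.mono j j≤l) y≤w)

        end≤ : ∀ {y} → y ≤ w → b + suc l * D + y ≤ V + V + w
        end≤ y≤w = +-mono-≤ (≤-trans (≤-reflexive (b+jD l)) (+-monoʳ-≤ V AP.end≤W)) y≤w

        t≤ : t ≤ V + V
        t≤ = +-monoʳ-≤ V (≤-trans (m≤m+n a _) AP.end≤W)

        result : MonochromaticAP (λ y → f (t + y)) (suc l) w ⊎
                 Focused (λ y → f (t + y)) l w k →
                 MonochromaticAP f (suc l) (V + V + w) ⊎ Focused f l (V + V + w) (suc k)
        result (inj₁ long) = inj₁ (translate t (+-monoˡ-≤ w t≤) long)
        result (inj₂ F) with Fin.any? (λ i → Focused.hue F i Fin.≟ f (t + Focused.focus F))
        ... | yes (i , hue≡) = inj₁ (translate t (+-monoˡ-≤ w t≤) (extend F i hue≡))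
        ... | no  hue≢       = inj₂ record
          -- The new focus sits in the window one step before the equal ones. Steps of `D` visit the
          -- copies of the old focus; steps of `D + diff i` follow the `i`-th progression while
          -- changing windows.
          { focus   = b + focus
          ; focus≤W = ≤-trans (+-monoˡ-≤ focus (m≤m+n b (suc l * D))) (end≤ focus≤W)
          ; diff    = D ∷ λ i → D + diff i
          ; diff>0  = λ { zero → AP.diff>0 ; (suc i) → ≤-trans AP.diff>0 (m≤m+n D _) }
          ; end≤W   = λ { zero    → ≤-trans (≤-reflexive (swap b focus _)) (end≤ focus≤W)
                        ; (suc i) → ≤-trans (≤-reflexive (split b focus l D (diff i)))
                                            (end≤ (end≤W i)) }
          ; hue     = f (t + focus) ∷ hue
          ; hue-injective = λ
            { zero    zero    _  → refl
            ; zero    (suc j) eq → contradiction (j , sym eq) hue≢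
            ; (suc i) zero    eq → contradiction (i , eq) hue≢
            ; (suc i) (suc j) eq → cong suc (hue-injective i j eq) }
          ; mono    = λ
            { zero    j j≤l → trans (cong f (swap b focus _)) (shift j focus j≤l focus≤W)
            ; (suc i) j j≤l → trans (cong f (split b focus j D (diff i)))
                (trans (shift j (focus + suc j * diff i) j≤l
                         (≤-trans (+-monoʳ-≤ focus (*-monoˡ-≤ (diff i) (s≤s j≤l))) (end≤W i)))
                       (mono i j j≤l)) }
          }
          where
          open Focused F
          swap : ∀ b e x → b + e + x ≡ b + x + e
          swap = solve-∀
          split : ∀ b e j D δ → b + e + suc j * (D + δ) ≡ b + suc j * D + (e + suc j * δ)
          split = solve-∀

    -- With `c` colours there cannot be `c + 1` progressions of pairwise different colours.
    vanDerWaerden-suc : ∃ λ W → (f : ℕ → Fin c) → MonochromaticAP f (suc l) W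
    vanDerWaerden-suc = proj₁ (focusing (suc c)) , λ f → conclude (proj₂ (focusing (suc c)) f)
      where
      conclude : ∀ {f : ℕ → Fin c} {W} → MonochromaticAP f (suc l) W ⊎ Focused f l W (suc c) →
                 MonochromaticAP f (suc l) W
      conclude (inj₁ ap) = ap
      conclude (inj₂ F)  with i , j , i<j , eq ← Fin.pigeonhole (n<1+n c) (Focused.hue F) =
        contradiction (Focused.hue-injective F i j eq) (Fin.<⇒≢ i<j)

  vanDerWaerden : ∀ l → VanDerWaerden l
  vanDerWaerden zero c = 1 , λ f → record
    { start = 0 ; diff = 1 ; diff>0 = s≤s z≤n ; diff≤W = s≤s z≤n ; end≤W = z≤n
    ; mono = λ { zero _ → refl } }
  vanDerWaerden (suc l) = vanDerWaerden-suc (vanDerWaerden l)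

-- Linear algebra of the alternating sum

open import Data.Integer.Base as ℤ using (ℤ; +_; -_; -[1+_]; ∣_∣; 0ℤ; 1ℤ; _+_; _*_; _^_)
import Data.Integer.Properties as ℤ
open import Data.Integer.Tactic.RingSolver using (solve-∀)
open import Algebra.Properties.Monoid.Sum ℤ.+-0-monoid using (sum; sum-syntax; sum-cong-≗)
open import Algebra.Properties.Semiring.Sum ℤ.+-*-semiring using (*-distribˡ-sum)

Σ⟨-2⟩ : ∀ {n} → Vector ℤ n → ℤ
Σ⟨-2⟩ {n} y = ∑[ i < n ] (neg2 ^ toℕ i * y i)

Σ⟨-2⟩-cong : ∀ {n} {y z : Vector ℤ n} → y ≗ z → Σ⟨-2⟩ y ≡ Σ⟨-2⟩ z
Σ⟨-2⟩-cong y≗z = sum-cong-≗ (λ i → cong (neg2 ^ toℕ i *_) (y≗z i))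

Σ⟨-2⟩-horner : ∀ {n} (y : Vector ℤ (suc n)) → Σ⟨-2⟩ y ≡ head y + neg2 * Σ⟨-2⟩ (tail y)
Σ⟨-2⟩-horner {n} y = cong₂ _+_ (ℤ.*-identityˡ (head y)) (begin
  (∑[ i < n ] (neg2 * neg2 ^ toℕ i * tail y i))   ≡⟨ sum-cong-≗ {n} (λ i → ℤ.*-assoc neg2 (neg2 ^ toℕ i) (tail y i)) ⟩
  (∑[ i < n ] (neg2 * (neg2 ^ toℕ i * tail y i))) ≡⟨ *-distribˡ-sum neg2 (λ i → neg2 ^ toℕ i * tail y i) ⟨
  neg2 * Σ⟨-2⟩ (tail y)                           ∎)
  where open ≡-Reasoning

Σ⟨-2⟩-linear : ∀ {n} a b (y z : Vector ℤ n) →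
               Σ⟨-2⟩ (λ i → a * y i + b * z i) ≡ a * Σ⟨-2⟩ y + b * Σ⟨-2⟩ z
Σ⟨-2⟩-linear {zero}  a b y z = sym (cong₂ _+_ (ℤ.*-zeroʳ a) (ℤ.*-zeroʳ b))
Σ⟨-2⟩-linear {suc n} a b y z = begin
  Σ⟨-2⟩ (λ i → a * y i + b * z i)
    ≡⟨ Σ⟨-2⟩-horner (λ i → a * y i + b * z i) ⟩
  a * head y + b * head z + neg2 * Σ⟨-2⟩ (λ i → a * tail y i + b * tail z i)
    ≡⟨ cong (λ s → a * head y + b * head z + neg2 * s) (Σ⟨-2⟩-linear a b (tail y) (tail z)) ⟩
  a * head y + b * head z + neg2 * (a * Σ⟨-2⟩ (tail y) + b * Σ⟨-2⟩ (tail z))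
    ≡⟨ regroup a b neg2 (head y) (head z) _ _ ⟩
  a * (head y + neg2 * Σ⟨-2⟩ (tail y)) + b * (head z + neg2 * Σ⟨-2⟩ (tail z))
    ≡⟨ cong₂ (λ s t → a * s + b * t) (Σ⟨-2⟩-horner y) (Σ⟨-2⟩-horner z) ⟨
  a * Σ⟨-2⟩ y + b * Σ⟨-2⟩ z ∎
  where
  open ≡-Reasoning
  regroup : ∀ a b q y z s t → a * y + b * z + q * (a * s + b * t) ≡
                              a * (y + q * s) + b * (z + q * t)
  regroup = solve-∀

-- Balanced assignments of values to the variables

data Level : Set where
  none low high : Level

-- A variable's value will be `weight` times `u(a + Ld)` plus `isNone` times `D m`, where
-- `D = 2^k u d`.
weight : ℕ → Level → ℕ
weight k none = 0
weight k low  = 1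
weight k high = 2 ℕ.^ k

isNone : Level → ℕ
isNone none = 1
isNone low  = 0
isNone high = 0

Σweight : ∀ {n} → ℕ → Vector Level n → ℤ
Σweight k lev = Σ⟨-2⟩ (λ i → + weight k (lev i))

Σnone : ∀ {n} → Vector Level n → ℤ
Σnone lev = Σ⟨-2⟩ (λ i → + isNone (lev i))

nones : ∀ {n} → Vector Level n
nones _ = none

lowAt : ∀ {n} → Fin n → Vector Level n
lowAt zero    = low ∷ nones
lowAt (suc i) = none ∷ lowAt i

Σweight-nones : ∀ n k → Σweight {n} k nones ≡ 0ℤ
Σweight-nones zero    k = refl
Σweight-nones (suc n) k = trans (Σ⟨-2⟩-horner {n} (λ _ → 0ℤ))
                                (cong (λ s → 0ℤ + neg2 * s) (Σweight-nones n k))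

Σweight-lowAt : ∀ {n} k (i : Fin n) → Σweight k (lowAt i) ≡ neg2 ^ toℕ i
Σweight-lowAt k (zero {n}) = trans (Σ⟨-2⟩-horner {n} (λ i → + weight k (lowAt zero i)))
                                 (cong (λ s → 1ℤ + neg2 * s) (Σweight-nones n k))
Σweight-lowAt k (suc i) = begin
  Σweight k (lowAt (suc i))            ≡⟨ Σ⟨-2⟩-horner (λ j → + weight k (lowAt (suc i) j)) ⟩
  0ℤ + neg2 * Σweight k (lowAt i)      ≡⟨ ℤ.+-identityˡ _ ⟩
  neg2 * Σweight k (lowAt i)           ≡⟨ cong (neg2 *_) (Σweight-lowAt k i) ⟩
  neg2 * neg2 ^ toℕ i                  ∎
  where open ≡-Reasoning

-- The alternatives stand for even and odd `k`; `balanced` splits on the sign instead of on parity.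
neg2^≡±2^ : ∀ k → neg2 ^ k ≡ + (2 ℕ.^ k) ⊎ neg2 ^ k ≡ - (+ (2 ℕ.^ k))
neg2^≡±2^ zero    = inj₁ refl
neg2^≡±2^ (suc k) with neg2^≡±2^ k
... | inj₁ eq = inj₂ (trans (cong (neg2 *_) eq)
                            (trans (sym (ℤ.neg-distribˡ-* (+ 2) (+ (2 ℕ.^ k))))
                                   (cong -_ (sym (ℤ.pos-* 2 (2 ℕ.^ k))))))
... | inj₂ eq = inj₁ (trans (cong (neg2 *_) eq)
                            (trans (cancel (+ (2 ℕ.^ k))) (sym (ℤ.pos-* 2 (2 ℕ.^ k)))))
  where
  cancel : ∀ p → -[1+ 1 ] * (- p) ≡ + 2 * p
  cancel = solve-∀

-- The levels describe x₁, …, xₙ only: x₀ is always at the high level.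
Balanced : ∀ {n} → ℕ → Vector Level n → Set
Balanced k lev = + (2 ℕ.^ k) + neg2 * Σweight k lev ≡ 0ℤ

-- For odd exponent e = k + 1 take x₀ = 2^e and x_e = 1; for even e take
-- x₀ = x₁ = 2^e and x_e = 1.
balanced : ∀ {n} (k : Fin n) → ∃ λ (lev : Vector Level n) → Balanced (suc (toℕ k)) lev
balanced k with neg2^≡±2^ (toℕ k)
... | inj₁ eq = lowAt k , (begin
  + (2 ℕ.* p) + neg2 * Σweight (suc (toℕ k)) (lowAt k)
    ≡⟨ cong₂ (λ a b → a + neg2 * b) (ℤ.pos-* 2 p) (trans (Σweight-lowAt (suc (toℕ k)) k) eq) ⟩
  + 2 * + p + neg2 * + p
    ≡⟨ cancel (+ p) ⟩
  0ℤ ∎)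
  where
  open ≡-Reasoning
  p = 2 ℕ.^ toℕ k
  cancel : ∀ p → + 2 * p + -[1+ 1 ] * p ≡ 0ℤ
  cancel = solve-∀
-- An even exponent `e` is at least 2, so x₁ and x_e are different variables.
balanced zero    | inj₂ ()
balanced (suc k) | inj₂ eq = high ∷ lowAt k , (begin
  + (2 ℕ.* p) + neg2 * Σweight k′ (high ∷ lowAt k)
    ≡⟨ cong (λ b → + (2 ℕ.* p) + neg2 * b) (Σ⟨-2⟩-horner (λ i → + weight k′ ((high ∷ lowAt k) i))) ⟩
  + (2 ℕ.* p) + neg2 * (+ (2 ℕ.* p) + neg2 * Σweight k′ (lowAt k))
    ≡⟨ cong₂ (λ a b → a + neg2 * (a + b)) (ℤ.pos-* 2 p)
             (trans (cong (neg2 *_) (Σweight-lowAt k′ k)) eq) ⟩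
  + 2 * + p + neg2 * (+ 2 * + p + - (+ p))
    ≡⟨ cancel (+ p) ⟩
  0ℤ ∎)
  where
  open ≡-Reasoning
  k′ = suc (suc (toℕ k))
  p = 2 ℕ.^ suc (toℕ k)
  cancel : ∀ p → + 2 * p + -[1+ 1 ] * (+ 2 * p + - p) ≡ 0ℤ
  cancel = solve-∀

fill : (k u a d L m : ℕ) → Level → ℕ
fill k u a d L m none = 2 ℕ.^ k ℕ.* (u ℕ.* d) ℕ.* m
fill k u a d L m low  = u ℕ.* (a ℕ.+ L ℕ.* d)
fill k u a d L m high = 2 ℕ.^ k ℕ.* (u ℕ.* (a ℕ.+ L ℕ.* d))

-- x₀ is the high value moved by (p - L) · 2^k u d, which compensates the
-- contribution of the variables outside the balanced part.
patch : ∀ {n} (k u a d L p m : ℕ) → Vector Level n → Vector ℕ (suc n)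
patch k u a d L p m lev = 2 ℕ.^ k ℕ.* (u ℕ.* (a ℕ.+ p ℕ.* d)) ∷ fill k u a d L m ∘ lev

-- The multiples of `u(a + Ld)` cancel by balance. What remains is `2^k u d (p - L)` from x₀ and
-- `-2 D m` times `Σnone lev`, and the choice of `p` makes these opposite.
patch-solves : ∀ {n} k u a d L p m (lev : Vector Level n) → Balanced k lev →
               + p ≡ + L + - (neg2 * Σnone lev * + m) →
               Σ⟨-2⟩ (+_ ∘ patch k u a d L p m lev) ≡ 0ℤ
patch-solves {n} k u a d L p m lev bal p≡ = begin
  Σ⟨-2⟩ (+_ ∘ patch k u a d L p m lev)
    ≡⟨ Σ⟨-2⟩-horner (+_ ∘ patch k u a d L p m lev) ⟩
  + (K ℕ.* (u ℕ.* (a ℕ.+ p ℕ.* d))) + neg2 * Σ⟨-2⟩ (+_ ∘ fill k u a d L m ∘ lev)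
    ≡⟨ cong₂ (λ x y → x + neg2 * y) (trans (ℤ.pos-* K _) (cong (+ K *_) (cast p)))
             (trans (Σ⟨-2⟩-cong (fill≡ ∘ lev))
                    (Σ⟨-2⟩-linear A B (λ i → + weight k (lev i)) (λ i → + isNone (lev i)))) ⟩
  + K * (+ u * (+ a + + p * + d)) + neg2 * (A * V + B * N)
    ≡⟨ cong₃ (λ p A B → + K * (+ u * (+ a + p * + d)) + neg2 * (A * V + B * N))
             p≡ (cast L) castB ⟩
  + K * (+ u * (+ a + (+ L + - (neg2 * N * + m)) * + d)) +
    neg2 * (+ u * (+ a + + L * + d) * V + + K * (+ u * + d) * + m * N)
    ≡⟨ regroup neg2 (+ K) (+ u) (+ a) (+ L) (+ d) (+ m) V N ⟩
  + u * (+ a + + L * + d) * (+ K + neg2 * V)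
    ≡⟨ cong (+ u * (+ a + + L * + d) *_) bal ⟩
  + u * (+ a + + L * + d) * 0ℤ
    ≡⟨ ℤ.*-zeroʳ (+ u * (+ a + + L * + d)) ⟩
  0ℤ ∎
  where
  open ≡-Reasoning
  K = 2 ℕ.^ k
  A = + (u ℕ.* (a ℕ.+ L ℕ.* d))
  B = + (K ℕ.* (u ℕ.* d) ℕ.* m)
  V = Σweight k lev
  N = Σnone lev
  cong₃ : ∀ {X : Set} (h : ℤ → ℤ → ℤ → X) {x x′ y y′ z z′} →
          x ≡ x′ → y ≡ y′ → z ≡ z′ → h x y z ≡ h x′ y′ z′
  cong₃ h refl refl refl = refl

  fill≡ : ∀ v → + fill k u a d L m v ≡ A * + weight k v + B * + isNone v
  fill≡ none = sym (trans (cong₂ _+_ (ℤ.*-zeroʳ A) (ℤ.*-identityʳ B)) (ℤ.+-identityˡ B))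
  fill≡ low  = sym (trans (cong₂ _+_ (ℤ.*-identityʳ A) (ℤ.*-zeroʳ B)) (ℤ.+-identityʳ A))
  fill≡ high = trans (trans (ℤ.pos-* K (u ℕ.* (a ℕ.+ L ℕ.* d))) (ℤ.*-comm (+ K) A))
                     (sym (trans (cong (λ x → A * + K + x) (ℤ.*-zeroʳ B)) (ℤ.+-identityʳ (A * + K))))

  cast : ∀ j → + (u ℕ.* (a ℕ.+ j ℕ.* d)) ≡ + u * (+ a + + j * + d)
  cast j = trans (ℤ.pos-* u (a ℕ.+ j ℕ.* d))
                 (cong (+ u *_) (trans (ℤ.pos-+ a (j ℕ.* d)) (cong (λ x → + a + x) (ℤ.pos-* j d))))

  castB : B ≡ + K * (+ u * + d) * + m
  castB = trans (ℤ.pos-* (K ℕ.* (u ℕ.* d)) m)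
                (cong (_* + m) (trans (ℤ.pos-* K (u ℕ.* d)) (cong (+ K *_) (ℤ.pos-* u d))))

  regroup : ∀ q K u a L d m V N →
            K * (u * (a + (L + - (q * N * m)) * d)) +
              q * (u * (a + L * d) * V + K * (u * d) * m * N) ≡
            u * (a + L * d) * (K + q * V)
  regroup = solve-∀

-- Regularity

bounded : ∀ {n} (g : Fin n → ℕ) → ∃ λ B → ∀ i → g i ≤ B
bounded {zero}  g = 0 , λ ()
bounded {suc n} g with B , g≤B ← bounded (g ∘ suc) =
  g zero ℕ.+ B , λ { zero    → ℕ.m≤m+n (g zero) B
                   ; (suc i) → ℕ.≤-trans (g≤B i) (ℕ.m≤n+m B (g zero)) }

-- The correction `z` may have either sign, so the base position `L` is the middle of a progression
-- with `2L` steps.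
offset : ∀ {L} z → ∣ z ∣ ≤ L → ∃ λ p → p ≤ L ℕ.+ L × + p ≡ + L + - z
offset {L} (+ n) n≤L =
  L ∸ n , ℕ.≤-trans (ℕ.m∸n≤m L n) (ℕ.m≤m+n L L) ,
  sym (trans (ℤ.m-n≡m⊖n L n) (ℤ.⊖-≥ n≤L))
offset {L} -[1+ n ] n<L = L ℕ.+ suc n , ℕ.+-monoʳ-≤ L n<L , refl

-- Declares the genuine colour `suc c` blank and renumbers the others, which lowers the number of
-- genuine colours by one.
merge : ∀ {s} → Fin (suc s) → Fin (suc (suc s)) → Fin (suc s)
merge c zero    = zero
merge c (suc e) with c Fin.≟ e
... | yes _   = zero
... | no  c≢e = suc (punchOut c≢e)

merge⁻¹-zero : ∀ {s} (c : Fin (suc s)) e → merge c e ≡ zero → e ≡ zero ⊎ e ≡ suc c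
merge⁻¹-zero c zero    _ = inj₁ refl
merge⁻¹-zero c (suc e) eq with c Fin.≟ e
... | yes refl = inj₂ refl

merge⁻¹-suc : ∀ {s} (c : Fin (suc s)) e {c′} → merge c e ≡ suc c′ → e ≡ suc (punchIn c c′)
merge⁻¹-suc c (suc e) eq with c Fin.≟ e
merge⁻¹-suc c (suc e) refl | no c≢e = cong suc (sym (Fin.punchIn-punchOut c≢e))

-- The bound `M` is fixed before the colouring: it limits the correction to x₀, so a sufficient
-- progression length can be chosen in advance.
Blank : ∀ {s} → (ℕ → Fin (suc s)) → ℕ → Set
Blank f M = ∃ λ m → 0 < m × m ≤ M × f m ≡ zero

Solves : ∀ {s} → ℕ → (ℕ → Fin (suc s)) → Set
Solves n f = ∃ λ (x : Vector ℕ (suc n)) →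
  Σ⟨-2⟩ (+_ ∘ x) ≡ 0ℤ × ∃ λ c → ∀ i → f (x i) ≡ suc c

-- Colour zero stands for "uncoloured", so s counts the genuine colours.
FinitelyRegular : ℕ → ℕ → Set
FinitelyRegular n s = ∃ λ M → (f : ℕ → Fin (suc s)) → Blank f M ⊎ Solves n f

Σ⟨-2⟩-scale : ∀ {n} D (x : Vector ℕ n) → Σ⟨-2⟩ (+_ ∘ x) ≡ 0ℤ → Σ⟨-2⟩ (λ i → + (D ℕ.* x i)) ≡ 0ℤ
Σ⟨-2⟩-scale D x eq = begin
  Σ⟨-2⟩ (λ i → + (D ℕ.* x i))
    ≡⟨ Σ⟨-2⟩-cong (λ i → trans (ℤ.pos-* D (x i)) (sym (ℤ.+-identityʳ (+ D * + x i)))) ⟩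
  Σ⟨-2⟩ (λ i → + D * + x i + 0ℤ * + x i)
    ≡⟨ Σ⟨-2⟩-linear (+ D) 0ℤ (+_ ∘ x) (+_ ∘ x) ⟩
  + D * Σ⟨-2⟩ (+_ ∘ x) + 0ℤ
    ≡⟨ cong (λ s → + D * s + 0ℤ) eq ⟩
  + D * 0ℤ + 0ℤ
    ≡⟨ cong (_+ 0ℤ) (ℤ.*-zeroʳ (+ D)) ⟩
  0ℤ ∎
  where open ≡-Reasoning

-- Induction step on the number of colours

module _ {n s : ℕ} (s<n : s < n) (reg : FinitelyRegular n s) where
  private
    M = proj₁ reg

    Tₖ : Fin n → ℤ
    Tₖ k = neg2 * Σnone (proj₁ (balanced k))

    -- The exponent `k` depends on the colouring, so `B` bounds the correction per unit of `m` for
    -- all `k` at once; `L` then bounds it for all `m ≤ M`.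
    B = proj₁ (bounded (∣_∣ ∘ Tₖ))
    L = B ℕ.* M
    -- Both the number of colours including blank and the number of powers 2^0, ..., 2^(s+1), one
    -- more than the `s + 1` genuine colours.
    r : ℕ
    r = suc (suc s)
    W = proj₁ (vanDerWaerden (L ℕ.+ L) (r ℕ.^ r))
    M′ = 2 ℕ.^ suc s ℕ.* suc W ℕ.* suc M

    step : (f : ℕ → Fin r) → Blank f M′ ⊎ Solves n f
    step f = search
      where
      octaves : ℕ → Fin r → Fin r
      octaves x i = f (2 ℕ.^ toℕ i ℕ.* suc x)

      ap = proj₂ (vanDerWaerden (L ℕ.+ L) (r ℕ.^ r)) (λ x → funToFin {r} (octaves x))
      module AP = MonochromaticAP ap
      a = suc AP.start
      d = AP.diff

      hue : Fin r → Fin r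
      hue i = f (2 ℕ.^ toℕ i ℕ.* a)

      mono : ∀ i j → j ≤ L ℕ.+ L → f (2 ℕ.^ toℕ i ℕ.* (a ℕ.+ j ℕ.* d)) ≡ hue i
      mono i j j≤ = funToFin-injective (octaves (AP.start ℕ.+ j ℕ.* d)) (octaves AP.start)
                                       (AP.mono j j≤) i

      2^≤ : (i : Fin r) → 2 ℕ.^ toℕ i ≤ 2 ℕ.^ suc s
      2^≤ i = ℕ.^-monoʳ-≤ 2 (ℕ.≤-pred (Fin.toℕ<n i))

      module _ (i j : Fin r) (i<j : i Fin.< j) (c : Fin (suc s))
               (i-hue : hue i ≡ suc c) (j-hue : hue j ≡ suc c) where
        -- `k₀ = j - i - 1` makes `k = j - i`, which is at most `s + 1` and hence at most `n`.
        k₀< : toℕ j ∸ suc (toℕ i) < n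
        k₀< = ℕ.≤-trans (ℕ.≤-trans (ℕ.≤-reflexive (sym (ℕ.+-∸-assoc 1 i<j)))
                                   (ℕ.≤-trans (ℕ.m∸n≤m (toℕ j) (toℕ i)) (ℕ.≤-pred (Fin.toℕ<n j)))) s<n
        k₀ = fromℕ< k₀<
        k = suc (toℕ k₀)
        k+i : k ℕ.+ toℕ i ≡ toℕ j
        k+i = begin
          suc (toℕ k₀ ℕ.+ toℕ i)                    ≡⟨ ℕ.+-suc (toℕ k₀) (toℕ i) ⟨
          toℕ k₀ ℕ.+ suc (toℕ i)                    ≡⟨ cong (ℕ._+ suc (toℕ i)) (Fin.toℕ-fromℕ< k₀<) ⟩
          toℕ j ∸ suc (toℕ i) ℕ.+ suc (toℕ i)       ≡⟨ ℕ.m∸n+n≡m i<j ⟩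
          toℕ j ∎
          where open ≡-Reasoning
        u = 2 ℕ.^ toℕ i
        D = 2 ℕ.^ k ℕ.* (u ℕ.* d)
        lev = proj₁ (balanced k₀)

        2^k*u* : ∀ x → 2 ℕ.^ k ℕ.* (u ℕ.* x) ≡ 2 ℕ.^ toℕ j ℕ.* x
        2^k*u* x = begin
          2 ℕ.^ k ℕ.* (u ℕ.* x)     ≡⟨ ℕ.*-assoc (2 ℕ.^ k) u x ⟨
          2 ℕ.^ k ℕ.* u ℕ.* x       ≡⟨ cong (ℕ._* x) (ℕ.^-distribˡ-+-* 2 k (toℕ i)) ⟨
          2 ℕ.^ (k ℕ.+ toℕ i) ℕ.* x ≡⟨ cong (λ e → 2 ℕ.^ e ℕ.* x) k+i ⟩
          2 ℕ.^ toℕ j ℕ.* x         ∎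
          where open ≡-Reasoning

        low-hue : ∀ p → p ≤ L ℕ.+ L → f (u ℕ.* (a ℕ.+ p ℕ.* d)) ≡ suc c
        low-hue p p≤ = trans (mono i p p≤) i-hue

        high-hue : ∀ p → p ≤ L ℕ.+ L → f (2 ℕ.^ k ℕ.* (u ℕ.* (a ℕ.+ p ℕ.* d))) ≡ suc c
        high-hue p p≤ = trans (cong f (2^k*u* _)) (trans (mono j p p≤) j-hue)

        patched : ∀ m → m ≤ M → f (D ℕ.* m) ≡ suc c → Solves n f
        patched m m≤M none-hue
          with p , p≤ , p≡ ← offset (Tₖ k₀ * + m)
                 (ℕ.≤-trans (ℕ.≤-reflexive (ℤ.abs-* (Tₖ k₀) (+ m)))
                            (ℕ.*-mono-≤ (proj₂ (bounded (∣_∣ ∘ Tₖ)) k₀) m≤M)) =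
          patch k u a d L p m lev ,
          patch-solves k u a d L p m lev (proj₂ (balanced k₀)) p≡ ,
          c , λ { zero → high-hue p p≤ ; (suc i) → fill-hue (lev i) }
          where
          fill-hue : ∀ v → f (fill k u a d L m v) ≡ suc c
          fill-hue none = none-hue
          fill-hue low  = low-hue L (ℕ.m≤m+n L L)
          fill-hue high = high-hue L (ℕ.m≤m+n L L)

        D*m>0 : ∀ m → 0 < m → 0 < D ℕ.* m
        D*m>0 m m>0 = ℕ.*-mono-≤ (ℕ.*-mono-≤ (ℕ.m^n>0 2 k) (ℕ.*-mono-≤ (ℕ.m^n>0 2 (toℕ i)) AP.diff>0)) m>0

        D*m≤M′ : ∀ m → m ≤ M → D ℕ.* m ≤ M′
        D*m≤M′ m m≤M = ℕ.*-mono-≤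
          (ℕ.≤-trans (ℕ.≤-reflexive (2^k*u* d)) (ℕ.*-mono-≤ (2^≤ j) (ℕ.m≤n⇒m≤1+n AP.diff≤W)))
          (ℕ.m≤n⇒m≤1+n m≤M)

        recurse : Blank f M′ ⊎ Solves n f
        -- Among the multiples of `D`, a solution in the remaining colours scales back by `D`; a
        -- merged blank is either a true blank or a value of the common colour, usable for
        -- `patched`.
        recurse with proj₂ reg (λ m → merge c (f (D ℕ.* m)))
        ... | inj₂ (x , sol , c′ , x-hue) =
          inj₂ ((λ i → D ℕ.* x i) , Σ⟨-2⟩-scale D x sol , punchIn c c′ ,
                λ i → merge⁻¹-suc c (f (D ℕ.* x i)) (x-hue i))
        ... | inj₁ (m , m>0 , m≤M , eq) with merge⁻¹-zero c (f (D ℕ.* m)) eq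
        ...   | inj₁ blank = inj₁ (D ℕ.* m , D*m>0 m m>0 , D*m≤M′ m m≤M , blank)
        ...   | inj₂ same  = inj₂ (patched m m≤M same)

      search : Blank f M′ ⊎ Solves n f
      search with Fin.any? (λ i → hue i Fin.≟ zero)
      ... | yes (i , blank) = inj₁
        ( 2 ℕ.^ toℕ i ℕ.* a
        , ℕ.*-mono-≤ (ℕ.m^n>0 2 (toℕ i)) (s≤s z≤n)
        , ℕ.≤-trans (ℕ.*-mono-≤ (2^≤ i) (s≤s (ℕ.≤-trans (ℕ.m≤m+n AP.start _) AP.end≤W)))
                    (ℕ.m≤m*n _ (suc M))
        , blank )
      -- None of the `s + 2` hues is blank, so they lie in `s + 1` genuine colours.
      ... | no coloured = collide (Fin.pigeonhole (ℕ.n<1+n (suc s)) (λ i → punchOut (0≢hue i)))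
        where
        0≢hue : ∀ i → zero ≢ hue i
        0≢hue i eq = coloured (i , sym eq)

        collide : (∃ λ i → ∃ λ j → i Fin.< j × punchOut (0≢hue i) ≡ punchOut (0≢hue j)) →
                  Blank f M′ ⊎ Solves n f
        collide (i , j , i<j , eq) = recurse i j i<j (punchOut (0≢hue i)) i-hue
          (trans (sym (Fin.punchOut-injective (0≢hue i) (0≢hue j) eq)) i-hue)
          where
          i-hue : hue i ≡ suc (punchOut (0≢hue i))
          i-hue = sym (Fin.punchIn-punchOut (0≢hue i))

  finitelyRegular-suc : FinitelyRegular n (suc s)
  finitelyRegular-suc = M′ , step

finitelyRegular : ∀ {n} s → s ≤ n → FinitelyRegular n s
finitelyRegular zero    _   = 1 , λ f → inj₁ (1 , s≤s z≤n , s≤s z≤n , ≡zero (f 1))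
  where
  ≡zero : (i : Fin 1) → i ≡ zero
  ≡zero zero = refl
finitelyRegular (suc s) s<n = finitelyRegular-suc s<n (finitelyRegular s (ℕ.<⇒≤ s<n))

regular : ∀ n → Regular n (alternatingPowersOf2 (suc n))
regular n C with proj₂ (finitelyRegular n ℕ.≤-refl) colour
  where
  colour : ℕ → Fin (suc n)
  -- Only 0 is blank: `Blank`, which asks for a positive number, is thus impossible, and a solution
  -- in a genuine colour avoids 0.
  colour zero    = zero
  colour (suc m) = suc (C (suc m , [ s≤s z≤n ]))
... | inj₁ (suc _ , _ , _ , ())
... | inj₂ (x , sol , c , x-hue) =
  proj₁ ∘ y ,
  trans (Σ⟨-2⟩-cong (λ i → cong +_ (proj₁ (proj₂ (y i))))) sol ,
  λ i j → trans (proj₂ (proj₂ (y i))) (sym (proj₂ (proj₂ (y j))))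
  where
  y : ∀ i → ∃ λ (z : ℕ⁺) → value z ≡ x i × C z ≡ c
  y i with x i | x-hue i
  ... | suc m | eq = (suc m , [ s≤s z≤n ]) , refl , Fin.suc-injective eq

-- Dyadic valuations

-- The 2-adic valuation of `z` is exactly `w`; the odd factor may be negative.
record Dyadic (w : ℕ) (z : ℤ) : Set where
  constructor _,_
  field
    y  : ℤ
    z≡ : z ≡ + (2 ℕ.^ w) * (1ℤ + + 2 * y)

1+2*≢0 : ∀ y → 1ℤ + + 2 * y ≢ 0ℤ
1+2*≢0 y odd≡0 = ℕ.even≢odd ∣ y ∣ 0 (begin
  2 ℕ.* ∣ y ∣            ≡⟨ ℤ.abs-* (+ 2) y ⟨
  ∣ + 2 * y ∣            ≡⟨ cong ∣_∣ (isolate y) ⟩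
  ∣ 1ℤ + + 2 * y + - 1ℤ ∣ ≡⟨ cong (λ e → ∣ e + - 1ℤ ∣) odd≡0 ⟩
  1 ∎)
  where
  open ≡-Reasoning
  isolate : ∀ y → + 2 * y ≡ + 1 + + 2 * y + - (+ 1)
  isolate = solve-∀

dyadic-nonZero : ∀ {w z} → Dyadic w z → z ≢ 0ℤ
dyadic-nonZero {w} (y , z≡) z≡0 with ℤ.i*j≡0⇒i≡0∨j≡0 (+ (2 ℕ.^ w)) (trans (sym z≡) z≡0)
... | inj₁ 2^w≡0 = ℕ.m<n⇒n≢0 (ℕ.m^n>0 2 w) (ℤ.+-injective 2^w≡0)
... | inj₂ odd≡0 = 1+2*≢0 y odd≡0

-- The sign goes into the odd factor: -(1 + 2y) = 1 + 2(-y - 1).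
dyadic-neg2* : ∀ {w z} → Dyadic w z → Dyadic (suc w) (neg2 * z)
dyadic-neg2* {w} (y , refl) = - y + - 1ℤ ,
  trans (regroup (+ (2 ℕ.^ w)) y) (cong (_* (1ℤ + + 2 * (- y + - 1ℤ))) (sym (ℤ.pos-* 2 (2 ℕ.^ w))))
  where
  regroup : ∀ p y → -[1+ 1 ] * (p * (+ 1 + + 2 * y)) ≡ + 2 * p * (+ 1 + + 2 * (- y + - (+ 1)))
  regroup = solve-∀

dyadic-neg2^* : ∀ {w z} i → Dyadic w z → Dyadic (i ℕ.+ w) (neg2 ^ i * z)
dyadic-neg2^* {z = z} zero    δ = subst (Dyadic _) (sym (ℤ.*-identityˡ z)) δ
dyadic-neg2^* {z = z} (suc i) δ =
  subst (Dyadic _) (sym (ℤ.*-assoc neg2 (neg2 ^ i) z)) (dyadic-neg2* (dyadic-neg2^* i δ))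

dyadic-+-< : ∀ {w w′ z z′} → w < w′ → Dyadic w z → Dyadic w′ z′ → Dyadic w (z + z′)
dyadic-+-< {w} {w′} w<w′ (y , refl) (y′ , refl) = y + q * (1ℤ + + 2 * y′) ,
  trans (cong (λ p′ → p * (1ℤ + + 2 * y) + p′ * (1ℤ + + 2 * y′)) split) (regroup p q y y′)
  where
  e = w′ ∸ suc w
  p = + (2 ℕ.^ w)
  q = + (2 ℕ.^ e)
  split : + (2 ℕ.^ w′) ≡ p * (+ 2 * q)
  split = begin
    + (2 ℕ.^ w′)                  ≡⟨ cong (λ v → + (2 ℕ.^ v)) (trans (ℕ.+-suc w e) (ℕ.m+[n∸m]≡n w<w′)) ⟨
    + (2 ℕ.^ (w ℕ.+ suc e))       ≡⟨ cong +_ (ℕ.^-distribˡ-+-* 2 w (suc e)) ⟩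
    + (2 ℕ.^ w ℕ.* (2 ℕ.* 2 ℕ.^ e)) ≡⟨ ℤ.pos-* (2 ℕ.^ w) _ ⟩
    p * + (2 ℕ.* 2 ℕ.^ e)         ≡⟨ cong (p *_) (ℤ.pos-* 2 (2 ℕ.^ e)) ⟩
    p * (+ 2 * q)                 ∎
    where open ≡-Reasoning
  regroup : ∀ p q y y′ → p * (+ 1 + + 2 * y) + p * (+ 2 * q) * (+ 1 + + 2 * y′) ≡
                         p * (+ 1 + + 2 * (y + q * (+ 1 + + 2 * y′)))
  regroup = solve-∀

-- Keeping the index of the valuation of the tail sum lets injectivity of `w` exclude a tie with the
-- head, so `dyadic-+-<` always applies.
dyadic-sum : ∀ {n} (w : Vector ℕ (suc n)) (z : Vector ℤ (suc n)) →
             (∀ i j → w i ≡ w j → i ≡ j) → (∀ i → Dyadic (w i) (z i)) →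
             ∃ λ i → Dyadic (w i) (sum z)
dyadic-sum {zero}  w z w-inj δ = zero , subst (Dyadic _) (sym (ℤ.+-identityʳ (z zero))) (δ zero)
dyadic-sum {suc n} w z w-inj δ
  with i , δᵢ ← dyadic-sum (tail w) (tail z) (λ i j eq → Fin.suc-injective (w-inj (suc i) (suc j) eq)) (δ ∘ suc)
  with ℕ.<-cmp (w zero) (w (suc i))
... | tri< w₀<wᵢ _ _ = zero , dyadic-+-< w₀<wᵢ (δ zero) δᵢ
... | tri≈ _ w₀≡wᵢ _ = contradiction (w-inj zero (suc i) w₀≡wᵢ) λ ()
... | tri> _ _ wᵢ<w₀ = suc i , subst (Dyadic _) (ℤ.+-comm (sum (tail z)) (z zero)) (dyadic-+-< wᵢ<w₀ δᵢ (δ zero))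

half : ∀ x → ∃ λ y → x ≡ 2 ℕ.* y ⊎ x ≡ suc (2 ℕ.* y)
half zero = 0 , inj₁ refl
half (suc x) with half x
... | y , inj₁ eq = y , inj₂ (cong suc eq)
... | y , inj₂ eq = suc y , inj₁ (trans (cong suc eq) (sym (ℕ.*-suc 2 y)))

dyadic-suc : ∀ x → Acc _<_ x → ∃ λ w → Dyadic w (+ suc x)
dyadic-suc x (acc rec) with half x
... | y , inj₁ refl = 0 , (+ y , trans (cong (λ e → 1ℤ + e) (ℤ.pos-* 2 y)) (sym (ℤ.*-identityˡ (1ℤ + + 2 * + y))))
... | y , inj₂ refl
  with w , (q , eq) ← dyadic-suc y (rec (s≤s (ℕ.m≤m+n y _))) = suc w , (q , (begin
  + suc (suc (2 ℕ.* y))                 ≡⟨ cong +_ (ℕ.*-suc 2 y) ⟨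
  + (2 ℕ.* suc y)                       ≡⟨ ℤ.pos-* 2 (suc y) ⟩
  + 2 * + suc y                         ≡⟨ cong (+ 2 *_) eq ⟩
  + 2 * (+ (2 ℕ.^ w) * (1ℤ + + 2 * q))  ≡⟨ ℤ.*-assoc (+ 2) (+ (2 ℕ.^ w)) (1ℤ + + 2 * q) ⟨
  + 2 * + (2 ℕ.^ w) * (1ℤ + + 2 * q)    ≡⟨ cong (_* (1ℤ + + 2 * q)) (ℤ.pos-* 2 (2 ℕ.^ w)) ⟨
  + (2 ℕ.^ suc w) * (1ℤ + + 2 * q)      ∎))
  where open ≡-Reasoning

dyadic : (z : ℕ⁺) → ∃ λ w → Dyadic w (+ value z)
dyadic (zero  , [ () ])
dyadic (suc x , _) = dyadic-suc x (<-wellFounded x)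

-- Cancelling the common remainder shows that `i` and `j` agree modulo `n`, and both are less than
-- `n`.
+-%-cancel : ∀ {n} .{{_ : ℕ.NonZero n}} {i j v w} → i < n → j < n →
             v % n ≡ w % n → i ℕ.+ v ≡ j ℕ.+ w → i ≡ j
+-%-cancel {n} {i} {j} {v} {w} i<n j<n v≡w eq = begin
  i                          ≡⟨ m<n⇒m%n≡m i<n ⟨
  i % n                      ≡⟨ [m+kn]%n≡m%n i (v / n) n ⟨
  (i ℕ.+ v / n ℕ.* n) % n    ≡⟨ cong (_% n) (ℕ.+-cancelˡ-≡ (v % n) _ _ quotients) ⟩
  (j ℕ.+ w / n ℕ.* n) % n    ≡⟨ [m+kn]%n≡m%n j (w / n) n ⟩
  j % n                      ≡⟨ m<n⇒m%n≡m j<n ⟩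
  j                          ∎
  where
  open ≡-Reasoning
  swap : ∀ i r q → r ℕ.+ (i ℕ.+ q) ≡ i ℕ.+ (r ℕ.+ q)
  swap = ℕSolver.solve-∀
  quotients : v % n ℕ.+ (i ℕ.+ v / n ℕ.* n) ≡ v % n ℕ.+ (j ℕ.+ w / n ℕ.* n)
  quotients = begin
    v % n ℕ.+ (i ℕ.+ v / n ℕ.* n)   ≡⟨ swap i (v % n) _ ⟩
    i ℕ.+ (v % n ℕ.+ v / n ℕ.* n)   ≡⟨ cong (i ℕ.+_) (m≡m%n+[m/n]*n v n) ⟨
    i ℕ.+ v                         ≡⟨ eq ⟩
    j ℕ.+ w                         ≡⟨ cong (j ℕ.+_) (m≡m%n+[m/n]*n w n) ⟩
    j ℕ.+ (w % n ℕ.+ w / n ℕ.* n)   ≡⟨ swap j (w % n) _ ⟨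
    w % n ℕ.+ (j ℕ.+ w / n ℕ.* n)   ≡⟨ cong (ℕ._+ _) v≡w ⟨
    v % n ℕ.+ (j ℕ.+ w / n ℕ.* n)   ∎

notRegular : ∀ n → ¬ Regular (suc n) (alternatingPowersOf2 (suc n))
notRegular n reg with x , sol , x-mono ← reg (λ z → proj₁ (dyadic z) mod suc n) =
  dyadic-nonZero (proj₂ (dyadic-sum w (λ i → neg2 ^ toℕ i * + value (x i)) w-injective
    (λ i → dyadic-neg2^* (toℕ i) (proj₂ (dyadic (x i)))))) sol
  where
  -- The valuations of the values x_i and of the terms (-2)^i x_i.
  v w : Vector ℕ (suc n)
  v i = proj₁ (dyadic (x i))
  w i = toℕ i ℕ.+ v i
  w-injective : ∀ i j → w i ≡ w j → i ≡ j
  w-injective i j eq = Fin.toℕ-injective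
    (+-%-cancel (Fin.toℕ<n i) (Fin.toℕ<n j)
      (Fin.fromℕ<-injective _ _ (m%n<n (v i) (suc n)) (m%n<n (v j) (suc n)) (x-mono i j)) eq)

theorem3p2 : (n : ℕ) → 2 ≤ n →
    Regular (n ∸ 1) (alternatingPowersOf2 n) × ¬ Regular n (alternatingPowersOf2 n)
theorem3p2 (suc n) _ = regular n , notRegular n
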